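{- Let $n\ge1$ and $L\ge0$ be integers. There is a constant $C=C(L,n)$ depending only on $L$ and $n$ such that the following holds. For every integer $d\ge1$, every $d$-maximal set $S\subset[n]^\infty$ containing no $(L+1)$-ball, and every integer $\ell\ge0$, \[ \bigl|S^{(\ell)}\bigr|\le C\,d^{2L+2}\,(n+8n^{2/3})^d . \]
   Context: $[n]=\{1,\dots,n\}$, $[n]^\infty$ is the set of infinite sequences over $[n]$, $\mathrm{dist}(a,b)=|\{i:a_i\ne b_i\}|$ is the Hamming distance, $\mathrm{diam}(S)=\sup_{a,b\in S}\mathrm{dist}(a,b)$. $S$ is $d$-maximal if $\mathrm{diam}(S)=d$ and $S$ is inclusion-maximal among subsets of $[n]^\infty$ of diameter $d$. $\mathrm{Ball}(a,r)=\{b\in[n]^\infty:\mathrm{dist}(a,b)\le r\}$; an $r$-ball is such a set, and $S$ contains an $r$-ball if $\mathrm{Ball}(a,r)\subset S$ for some $a$. For $S\subset[n]^\infty$, \[ S^{(\ell)}=\{a\in S:\ \mathrm{Ball}(a,\ell)\subset S,\ \text{and there is no } b\in[n]^\infty \text{ with } \mathrm{Ball}(a,\ell)\subset\mathrm{Ball}(b,\ell+1)\subset S\}. \] -}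

module Defs where

open import Data.Nat using (ℕ; suc; _≤_; _+_)
open import Data.Fin using (Fin)
open import Data.List using (List; length)
open import Data.List.Relation.Unary.All using (All)
open import Data.List.Relation.Unary.AllPairs using (AllPairs)
open import Data.Product using (Σ; _×_; ∃)
open import Relation.Nullary using (¬_)
open import Relation.Binary.PropositionalEquality using (_≡_; _≢_)

Seq : ℕ → Set
Seq n = ℕ → Fin n

_≈_ : ∀ {n} → Seq n → Seq n → Set
a ≈ b = ∀ i → a i ≡ b i

AtMost : {A : Set} → (A → A → Set) → (A → Set) → ℕ → Set
AtMost {A} _~_ P r =
  (xs : List A) → AllPairs (λ x y → ¬ (x ~ y)) xs → All P xs → length xs ≤ r

DistLe : ∀ {n} → Seq n → Seq n → ℕ → Set
DistLe a b r = AtMost _≡_ (λ i → a i ≢ b i) r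

DistGe : ∀ {n} → Seq n → Seq n → ℕ → Set
DistGe a b r = Σ (List ℕ) λ xs →
  AllPairs (λ x y → x ≢ y) xs × All (λ i → a i ≢ b i) xs × length xs ≡ r

Subset : ℕ → Set₁
Subset n = Seq n → Set

_⊆_ : ∀ {n} → Subset n → Subset n → Set
S ⊆ T = ∀ a → S a → T a

-- diam(S) = d  (the sup of a set of naturals ≤ d is attained).
Diam : ∀ {n} → Subset n → ℕ → Set
Diam S d =
  (∀ a b → S a → S b → DistLe a b d) ×
  Σ _ λ a → Σ _ λ b → S a × S b × DistGe a b d

Maximal : ∀ {n} → Subset n → ℕ → Set₁
Maximal {n} S d = Diam S d × ((T : Subset n) → S ⊆ T → Diam T d → T ⊆ S)

Ball : ∀ {n} → Seq n → ℕ → Subset n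
Ball a r b = DistLe a b r

ContainsBall : ∀ {n} → Subset n → ℕ → Set
ContainsBall S r = ∃ λ a → Ball a r ⊆ S

Layer : ∀ {n} → Subset n → ℕ → Subset n
Layer {n} S ℓ a =
  S a × (Ball a ℓ ⊆ S) ×
  ¬ (Σ (Seq n) λ b → (Ball a ℓ ⊆ Ball b (suc ℓ)) × (Ball b (suc ℓ) ⊆ S))

CardLe : ∀ {n} → Subset n → ℕ → Set
CardLe S N = AtMost _≈_ S N

{-# OPTIONS --safe #-}
module Submission where

-- Write k = d − ℓ. Every a in S^(ℓ) is at distance at most k from all of S.
--
-- Local step. Let a in S^(ℓ) be at distance r ≥ 1 from some point z. By maximality,
-- some s in S is far from z: otherwise S contains an (L+1)-ball around z (if r > L),
-- or an (ℓ+1)-ball containing Ball(a,ℓ) (if r ≤ L). Since a is within k of s, it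
-- differs from z on about r/2 of the positions where z and s differ. Moving z to the
-- value of a on one of these and double counting gives at most (2nd)^r / (r−L)!
-- elements of S^(ℓ) at distance r from z.
--
-- Global step. Let z₀, s₀ in S differ exactly on D with |D| = d. If a in S^(ℓ) differs
-- from z₀ in r positions outside D, then d(a,z₀), d(a,s₀) ≤ d force at least 2r
-- positions of D on which a takes the value of z₀ or of s₀. Guess a on D with weight
-- 2n^(2/3) for these two values and 1 for all others, at a total cost of
-- (n + 4n^(2/3))^d, and apply the local step to the resulting point. As
-- d^r/r! ≤ y^(−r) (1−y)^(−d), the choice y = n^(−1/3)/2 makes the local bound at most
-- d^L (2n^(2/3))^(2r) (1−y)^(−d), and (n + 4n^(2/3))/(1−y) ≤ n + 8n^(2/3) for n ≥ 2.

open import Defs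
open import Data.Bool using (Bool; true; false; if_then_else_; _∨_)
open import Data.Fin using (Fin; _≟_) renaming (zero to fzero; suc to fsuc)
open import Data.List using (List; []; _∷_; length; filter; downFrom; allFin)
open import Data.List.Membership.Propositional using (_∈_)
open import Data.List.Membership.Propositional.Properties using (∈-filter⁺; ∈-allFin; ∈-downFrom⁺; ∈-downFrom⁻)
open import Data.List.Properties using (length-tabulate; length-downFrom)
open import Data.List.Relation.Unary.All as All using (All; []; _∷_)
open import Data.List.Relation.Unary.All.Properties using (all-filter) renaming (filter⁺ to All-filter⁺)
open import Data.List.Relation.Unary.AllPairs using (AllPairs; []; _∷_)
open import Data.List.Relation.Unary.AllPairs.Properties using () renaming (filter⁺ to AllPairs-filter⁺)
open import Data.List.Relation.Unary.Any using (here; there)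
open import Data.List.Relation.Unary.Unique.Propositional using (Unique)
open import Data.List.Relation.Unary.Unique.Propositional.Properties using (downFrom⁺; allFin⁺)
open import Data.Nat hiding (_≟_)
open import Data.Nat.Properties as ℕ hiding (_≟_)
open import Data.Nat.Tactic.RingSolver using (solve-∀)
open import Data.Product using (Σ; _×_; _,_; proj₁; proj₂)
open import Data.Sum using (_⊎_; inj₁; inj₂)
open import Function using (_∘_; id)
open import Relation.Binary.Definitions using (DecidableEquality)
open import Relation.Binary.PropositionalEquality using (_≡_; _≢_; refl; sym; trans; cong; cong₂; subst)
open import Relation.Nullary using (¬_; Dec; yes; no; does; ¬?; contradiction)
open import Relation.Nullary.Decidable using (decidable-stable; dec-true; dec-false)

private
  variable
    A B : Set

-- Finite sums and counting

∑ : List A → (A → ℕ) → ℕ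
∑ []       f = 0
∑ (x ∷ xs) f = f x + ∑ xs f

∏ : List A → (A → ℕ) → ℕ
∏ []       f = 1
∏ (x ∷ xs) f = f x * ∏ xs f

∑-mono : ∀ (xs : List A) {f g : A → ℕ} → (∀ x → x ∈ xs → f x ≤ g x) → ∑ xs f ≤ ∑ xs g
∑-mono []       f≤g = z≤n
∑-mono (x ∷ xs) f≤g = +-mono-≤ (f≤g x (here refl)) (∑-mono xs (λ y → f≤g y ∘ there))

∑-cong : ∀ (xs : List A) {f g : A → ℕ} → (∀ x → x ∈ xs → f x ≡ g x) → ∑ xs f ≡ ∑ xs g
∑-cong []       f≡g = refl
∑-cong (x ∷ xs) f≡g = cong₂ _+_ (f≡g x (here refl)) (∑-cong xs (λ y → f≡g y ∘ there))

∏-cong : ∀ (xs : List A) {f g : A → ℕ} → (∀ x → x ∈ xs → f x ≡ g x) → ∏ xs f ≡ ∏ xs g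
∏-cong []       f≡g = refl
∏-cong (x ∷ xs) f≡g = cong₂ _*_ (f≡g x (here refl)) (∏-cong xs (λ y → f≡g y ∘ there))

∑-+ : ∀ (xs : List A) (f g : A → ℕ) → ∑ xs (λ x → f x + g x) ≡ ∑ xs f + ∑ xs g
∑-+ []       f g = refl
∑-+ (x ∷ xs) f g rewrite ∑-+ xs f g = interchange (f x) (g x) (∑ xs f) (∑ xs g)
  where
  interchange : ∀ a b c d → a + b + (c + d) ≡ a + c + (b + d)
  interchange = solve-∀

∑-const : ∀ (xs : List A) c → ∑ xs (λ _ → c) ≡ length xs * c
∑-const []       c = refl
∑-const (x ∷ xs) c = cong (c +_) (∑-const xs c)

∑-*ˡ : ∀ (xs : List A) c (f : A → ℕ) → ∑ xs (λ x → c * f x) ≡ c * ∑ xs f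
∑-*ˡ []       c f = sym (*-zeroʳ c)
∑-*ˡ (x ∷ xs) c f rewrite ∑-*ˡ xs c f = sym (*-distribˡ-+ c (f x) (∑ xs f))

∑-*ʳ : ∀ (xs : List A) c (f : A → ℕ) → ∑ xs (λ x → f x * c) ≡ ∑ xs f * c
∑-*ʳ []       c f = refl
∑-*ʳ (x ∷ xs) c f rewrite ∑-*ʳ xs c f = sym (*-distribʳ-+ c (f x) (∑ xs f))

∑-swap : ∀ (xs : List A) (ys : List B) (f : A → B → ℕ) →
         ∑ xs (λ x → ∑ ys (f x)) ≡ ∑ ys (λ y → ∑ xs (λ x → f x y))
∑-swap []       ys f = sym (trans (∑-const ys 0) (*-zeroʳ (length ys)))
∑-swap (x ∷ xs) ys f rewrite ∑-swap xs ys f = sym (∑-+ ys (f x) (λ y → ∑ xs (λ x → f x y)))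

∑-bound : ∀ (xs : List A) {f : A → ℕ} {c} → (∀ x → x ∈ xs → f x ≤ c) → ∑ xs f ≤ length xs * c
∑-bound xs {c = c} f≤c = ≤-trans (∑-mono xs f≤c) (≤-reflexive (∑-const xs c))

∏-bound : ∀ (xs : List A) {f : A → ℕ} {c} → (∀ x → f x ≤ c) → ∏ xs f ≤ c ^ length xs
∏-bound []       f≤c = ≤-refl
∏-bound (x ∷ xs) f≤c = *-mono-≤ (f≤c x) (∏-bound xs f≤c)

∈⇒≤∑ : ∀ {xs : List A} (f : A → ℕ) {x} → x ∈ xs → f x ≤ ∑ xs f
∈⇒≤∑ f (here refl) = m≤m+n _ _
∈⇒≤∑ f (there x∈xs) = ≤-trans (∈⇒≤∑ f x∈xs) (m≤n+m _ _)

ι : ∀ {P : Set} → Dec P → ℕ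
ι P? = if does P? then 1 else 0

ι-yes : ∀ {P : Set} (P? : Dec P) → P → ι P? ≡ 1
ι-yes P? p rewrite dec-true P? p = refl

ι-no : ∀ {P : Set} (P? : Dec P) → ¬ P → ι P? ≡ 0
ι-no P? ¬p rewrite dec-false P? ¬p = refl

length-filter : ∀ {P : A → Set} (P? : ∀ x → Dec (P x)) xs → length (filter P? xs) ≡ ∑ xs (ι ∘ P?)
length-filter P? []       = refl
length-filter P? (x ∷ xs) with does (P? x)
... | true  = cong suc (length-filter P? xs)
... | false = length-filter P? xs

∑-filter : ∀ {P : A → Set} (P? : ∀ x → Dec (P x)) xs f →
           ∑ (filter P? xs) f ≡ ∑ xs (λ x → ι (P? x) * f x)
∑-filter P? []       f = refl
∑-filter P? (x ∷ xs) f with does (P? x)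
... | true  = cong₂ _+_ (sym (*-identityˡ (f x))) (∑-filter P? xs f)
... | false = ∑-filter P? xs f

-- The tool for every split of a list by a coordinate value or by a distance. Exchanging the two
-- sums counts each entry at least once, under its own key.
length≤∑-fibres : (_≟′_ : DecidableEquality B) (key : A → B) (vs : List B) (xs : List A) →
  (∀ x → x ∈ xs → key x ∈ vs) →
  length xs ≤ ∑ vs (λ v → length (filter (λ x → key x ≟′ v) xs))
length≤∑-fibres _≟′_ key vs xs key∈ = begin
  length xs                                             ≡⟨ *-identityʳ _ ⟨
  length xs * 1                                         ≡⟨ ∑-const xs 1 ⟨
  ∑ xs (λ _ → 1)                                        ≤⟨ ∑-mono xs one≤ ⟩
  ∑ xs (λ x → ∑ vs (λ v → ι (key x ≟′ v)))              ≡⟨ ∑-swap xs vs _ ⟩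
  ∑ vs (λ v → ∑ xs (λ x → ι (key x ≟′ v)))              ≡⟨ ∑-cong vs (λ v _ → length-filter (λ x → key x ≟′ v) xs) ⟨
  ∑ vs (λ v → length (filter (λ x → key x ≟′ v) xs))    ∎
  where
  open ≤-Reasoning
  one≤ : ∀ x → x ∈ xs → 1 ≤ ∑ vs (λ v → ι (key x ≟′ v))
  one≤ x x∈xs = ≤-trans (≤-reflexive (sym (ι-yes (key x ≟′ key x) refl)))
                        (∈⇒≤∑ (λ v → ι (key x ≟′ v)) (key∈ x x∈xs))

length≤1 : ∀ {_~_ : A → A → Set} {xs : List A} → AllPairs (λ x y → ¬ (x ~ y)) xs →
           (∀ x y → x ∈ xs → y ∈ xs → x ~ y) → length xs ≤ 1
length≤1 {xs = []}         _                 _ = z≤n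
length≤1 {xs = x ∷ []}     _                 _ = ≤-refl
length≤1 {xs = x ∷ y ∷ xs} ((¬x~y ∷ _) ∷ _)  r =
  contradiction (r x y (here refl) (there (here refl))) ¬x~y

length-≟-filter≤1 : (_≟′_ : DecidableEquality A) {vs : List A} → Unique vs → ∀ x →
                    length (filter (_≟′ x) vs) ≤ 1
length-≟-filter≤1 _≟′_ {vs} vs! x =
  length≤1 (AllPairs-filter⁺ (_≟′ x) vs!)
    (λ y z y∈ z∈ → trans (All.lookup eqs y∈) (sym (All.lookup eqs z∈)))
  where eqs = all-filter (_≟′ x) vs

-- Hamming distance on an initial segment

δ : ∀ {n} → Fin n → Fin n → ℕ
δ x y = ι (¬? (x ≟ y))

δ≤1 : ∀ {n} (x y : Fin n) → δ x y ≤ 1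
δ≤1 x y with x ≟ y
... | yes _ = z≤n
... | no  _ = ≤-refl

δ-≡ : ∀ {n} {x y : Fin n} → x ≡ y → δ x y ≡ 0
δ-≡ {x = x} {y} x≡y = ι-no (¬? (x ≟ y)) (λ x≢y → x≢y x≡y)

δ-≢ : ∀ {n} {x y : Fin n} → x ≢ y → δ x y ≡ 1
δ-≢ {x = x} {y} x≢y = ι-yes (¬? (x ≟ y)) x≢y

δ-sym : ∀ {n} (x y : Fin n) → δ x y ≡ δ y x
δ-sym x y with x ≟ y
... | yes x≡y = sym (δ-≡ (sym x≡y))
... | no  x≢y = sym (δ-≢ (x≢y ∘ sym))

δ-triangle : ∀ {n} (x y z : Fin n) → δ x z ≤ δ x y + δ y z
δ-triangle x y z with x ≟ y
... | yes refl = ≤-refl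
... | no  _    = ≤-trans (δ≤1 x z) (m≤m+n 1 _)

-- Whether two infinite sequences differ in at most r places is not decidable, while the differences
-- below `N` can be counted. `DistLe a b r` amounts to `dist N a b ≤ r` for all `N`, so the proof
-- works with these truncations.
dist : ∀ {n} → ℕ → Seq n → Seq n → ℕ
dist N a b = ∑ (downFrom N) (λ i → δ (a i) (b i))

dist-sym : ∀ {n} N (a b : Seq n) → dist N a b ≡ dist N b a
dist-sym N a b = ∑-cong (downFrom N) (λ i _ → δ-sym (a i) (b i))

dist-triangle : ∀ {n} N (a b c : Seq n) → dist N a c ≤ dist N a b + dist N b c
dist-triangle N a b c = begin
  dist N a c                                              ≤⟨ ∑-mono (downFrom N) (λ i _ → δ-triangle (a i) (b i) (c i)) ⟩
  ∑ (downFrom N) (λ i → δ (a i) (b i) + δ (b i) (c i))    ≡⟨ ∑-+ (downFrom N) _ _ ⟩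
  dist N a b + dist N b c                                 ∎
  where open ≤-Reasoning

dist-mono : ∀ {n} {M N} (a b : Seq n) → M ≤ N → dist M a b ≤ dist N a b
dist-mono a b M≤N = go (≤⇒≤′ M≤N)
  where
  go : ∀ {M N} → M ≤′ N → dist M a b ≤ dist N a b
  go ≤′-refl       = ≤-refl
  go (≤′-step M≤N) = ≤-trans (go M≤N) (m≤n+m _ _)

DistLe⇒dist≤ : ∀ {n} {a b : Seq n} {r} → DistLe a b r → ∀ N → dist N a b ≤ r
DistLe⇒dist≤ {a = a} {b} {r} a~b N =
  subst (_≤ r) (length-filter differ? (downFrom N))
    (a~b _ (AllPairs-filter⁺ differ? (downFrom⁺ N)) (all-filter differ? (downFrom N)))
  where
  differ? = λ i → ¬? (a i ≟ b i)

bound : (xs : List ℕ) → Σ ℕ λ N → All (_< N) xs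
bound []       = 0 , []
bound (x ∷ xs) with bound xs
... | N , xs<N = suc x ⊔ N , m≤m⊔n (suc x) N ∷ All.map (λ y<N → ≤-trans y<N (m≤n⊔m (suc x) N)) xs<N

-- Without repetitions each position below `N` occurs at most once in `xs`, and only if `a` and `b`
-- differ there; so its fibre is no larger than its summand in `dist`.
length≤dist : ∀ {n} {a b : Seq n} {N xs} → Unique xs → All (_< N) xs →
              All (λ i → a i ≢ b i) xs → length xs ≤ dist N a b
length≤dist {a = a} {b} {N} {xs} xs! xs<N a≢b = begin
  length xs                                              ≤⟨ length≤∑-fibres ℕ._≟_ id (downFrom N) xs
                                                             (λ i → ∈-downFrom⁺ ∘ All.lookup xs<N) ⟩
  ∑ (downFrom N) (λ i → length (filter (ℕ._≟ i) xs))     ≤⟨ ∑-mono (downFrom N) (λ i _ → fibre≤δ i) ⟩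
  dist N a b                                             ∎
  where
  open ≤-Reasoning
  fibre≤δ : ∀ i → length (filter (ℕ._≟ i) xs) ≤ δ (a i) (b i)
  fibre≤δ i with filter (ℕ._≟ i) xs | all-filter (ℕ._≟ i) xs | All-filter⁺ (ℕ._≟ i) a≢b | length-≟-filter≤1 ℕ._≟_ xs! i
  ... | []     | _        | _      | _  = z≤n
  ... | _ ∷ _  | refl ∷ _ | ne ∷ _ | l≤ = ≤-trans l≤ (≤-reflexive (sym (δ-≢ ne)))

dist≤⇒DistLe : ∀ {n} {a b : Seq n} {r} → (∀ N → dist N a b ≤ r) → DistLe a b r
dist≤⇒DistLe d≤r xs xs! a≢b with bound xs
... | N , xs<N = ≤-trans (length≤dist xs! xs<N a≢b) (d≤r N)

DistGe⇒≤dist : ∀ {n} {a b : Seq n} {r} → DistGe a b r → Σ ℕ λ N → r ≤ dist N a b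
DistGe⇒≤dist (xs , xs! , a≢b , refl) with bound xs
... | N , xs<N = N , length≤dist xs! xs<N a≢b

_[_≔_] : ∀ {n} → Seq n → ℕ → Fin n → Seq n
(a [ i ≔ v ]) j = if does (j ℕ.≟ i) then v else a j

≔-here : ∀ {n} (a : Seq n) {i j} v → j ≡ i → (a [ i ≔ v ]) j ≡ v
≔-here a {i} {j} v j≡i rewrite dec-true (j ℕ.≟ i) j≡i = refl

≔-there : ∀ {n} (a : Seq n) {i j} v → j ≢ i → (a [ i ≔ v ]) j ≡ a j
≔-there a {i} {j} v j≢i rewrite dec-false (j ℕ.≟ i) j≢i = refl

-- The move of the local step. The drop by exactly one is what lets `local-bound` recurse on
-- sequences at one fixed distance.
dist-≔ : ∀ {n} {z a : Seq n} {N i v} → i < N → z i ≢ a i → a i ≡ v →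
         dist N z a ≡ suc (dist N (z [ i ≔ v ]) a)
dist-≔ {z = z} {a} {suc N} {i} {v} i<N zi≢ai ai≡v with N ℕ.≟ i
... | yes refl = cong₂ _+_ (δ-≢ zi≢ai) (trans
        (∑-cong (downFrom N) (λ j j∈ → cong (λ x → δ x (a j))
          (sym (≔-there z v (<⇒≢ (∈-downFrom⁻ j∈))))))
        (cong (_+ dist N (z [ i ≔ v ]) a) (sym (δ-≡ (trans (≔-here z {N} v refl) (sym ai≡v))))))
... | no N≢i =
  trans (cong₂ _+_ (cong (λ x → δ x (a N)) (sym (≔-there z v N≢i)))
                   (dist-≔ (≤∧≢⇒< (s≤s⁻¹ i<N) (N≢i ∘ sym)) zi≢ai ai≡v))
        (+-suc _ _)

-- Agreement beyond a finite cutoff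

Agree : ∀ {n} → ℕ → Seq n → Seq n → Set
Agree N a b = ∀ i → N ≤ i → a i ≡ b i

-- If no cutoff existed, there would be a difference beyond every position, and r + 1 of them would
-- exceed the bound. The cutoff cannot be computed, hence the double negation; it is removed where
-- the goal is an inequality of naturals.
¬¬-Agree : ∀ {n} {a b : Seq n} {r} → (∀ N → dist N a b ≤ r) → ¬ ¬ Σ ℕ λ N → Agree N a b
¬¬-Agree {a = a} {b} {r} d≤r ¬agree = unbounded (suc r) λ (N , r<d) → <⇒≱ r<d (d≤r N)
  where
  next : ∀ N → ¬ ¬ Σ ℕ λ i → N ≤ i × a i ≢ b i
  next N ¬i = ¬agree (N , λ i N≤i → decidable-stable (a i ≟ b i) (λ ne → ¬i (i , N≤i , ne)))
  unbounded : ∀ j → ¬ ¬ Σ ℕ λ N → j ≤ dist N a b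
  unbounded zero    k = k (0 , z≤n)
  unbounded (suc j) k = unbounded j λ (N , j≤d) → next N λ (i , N≤i , ne) →
    k (suc i , +-mono-≤ (≤-reflexive (sym (δ-≢ ne))) (≤-trans j≤d (dist-mono a b N≤i)))

¬¬-All-Agree : ∀ {n} {a : Seq n} {r} {xs : List (Seq n)} → All (λ b → ∀ N → dist N a b ≤ r) xs →
               ∀ M → ¬ ¬ Σ ℕ λ N → M ≤ N × All (Agree N a) xs
¬¬-All-Agree []             M k = k (M , ≤-refl , [])
¬¬-All-Agree (d≤r ∷ ds≤r) M k = ¬¬-Agree d≤r λ (N₁ , agree) →
  ¬¬-All-Agree ds≤r (M ⊔ N₁) λ (N , M≤N , agrees) →
    k (N , ≤-trans (m≤m⊔n M N₁) M≤N ,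
       (λ i N≤i → agree i (≤-trans (≤-trans (m≤n⊔m M N₁) M≤N) N≤i)) ∷ agrees)

dist-Agree : ∀ {n} {a b : Seq n} {M N} → M ≤ N → Agree M a b → dist N a b ≡ dist M a b
dist-Agree {a = a} {b} {M} M≤N agree = go (≤⇒≤′ M≤N)
  where
  go : ∀ {N} → M ≤′ N → dist N a b ≡ dist M a b
  go ≤′-refl       = refl
  go (≤′-step M≤N) = cong₂ _+_ (δ-≡ (agree _ (≤′⇒≤ M≤N))) (go M≤N)

-- Numerical estimates

^-distribʳ-* : ∀ a b m → (a * b) ^ m ≡ a ^ m * b ^ m
^-distribʳ-* a b zero    = refl
^-distribʳ-* a b (suc m) rewrite ^-distribʳ-* a b m = interchange a b (a ^ m) (b ^ m)
  where
  interchange : ∀ a b c d → a * b * (c * d) ≡ a * c * (b * d)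
  interchange = solve-∀

-- The binomial coefficient of d + r - 1 over r, that is, the coefficient of y^r in (1 - y)^(-d);
-- the recursion is Pascal's rule.
multichoose : ℕ → ℕ → ℕ
multichoose d       zero    = 1
multichoose zero    (suc r) = 0
multichoose (suc d) (suc r) = multichoose d (suc r) + multichoose (suc d) r

-- With the factor d + r on the left this would be an equality. The factor d suffices: iterated, it
-- gives d^r ≤ r! `multichoose d r`.
multichoose-step : ∀ d r → d * multichoose d r ≤ suc r * multichoose d (suc r)
multichoose-step zero    r       = z≤n
multichoose-step (suc d) zero    = begin
  suc d * 1                              ≡⟨ *-identityʳ (suc d) ⟩
  suc d                                  ≡⟨ +-comm 1 d ⟩
  d + 1                                  ≡⟨ cong (_+ 1) (*-identityʳ d) ⟨
  d * 1 + 1                              ≤⟨ +-monoˡ-≤ 1 (multichoose-step d zero) ⟩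
  1 * multichoose d 1 + 1                ≡⟨ cong (_+ 1) (*-identityˡ (multichoose d 1)) ⟩
  multichoose d 1 + 1                    ≡⟨ *-identityˡ (multichoose d 1 + 1) ⟨
  1 * multichoose (suc d) 1              ∎
  where open ≤-Reasoning
multichoose-step (suc d) (suc r) = begin
  suc d * (x + y)                        ≡⟨ split d x y ⟩
  (d * x + (x + y)) + d * y              ≤⟨ +-mono-≤ (+-monoˡ-≤ (x + y) (multichoose-step d (suc r)))
                                              (≤-trans (m≤n+m (d * y) y) (multichoose-step (suc d) r)) ⟩
  (suc (suc r) * z + (x + y)) + suc r * (x + y) ≡⟨ merge r z (x + y) ⟩
  suc (suc r) * (z + (x + y))            ∎
  where
  open ≤-Reasoning
  x = multichoose d (suc r)
  y = multichoose (suc d) r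
  z = multichoose d (suc (suc r))
  split : ∀ d x y → suc d * (x + y) ≡ (d * x + (x + y)) + d * y
  split = solve-∀
  merge : ∀ r z s → (suc (suc r) * z + s) + suc r * s ≡ suc (suc r) * (z + s)
  merge = solve-∀

^≤!*multichoose : ∀ d r → d ^ r ≤ r ! * multichoose d r
^≤!*multichoose d zero    = ≤-refl
^≤!*multichoose d (suc r) = begin
  d * d ^ r                                ≤⟨ *-monoʳ-≤ d (^≤!*multichoose d r) ⟩
  d * (r ! * multichoose d r)              ≡⟨ swap d (r !) (multichoose d r) ⟩
  r ! * (d * multichoose d r)              ≤⟨ *-monoʳ-≤ (r !) (multichoose-step d r) ⟩
  r ! * (suc r * multichoose d (suc r))    ≡⟨ swap′ (r !) (suc r) (multichoose d (suc r)) ⟩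
  suc r ! * multichoose d (suc r)          ∎
  where
  open ≤-Reasoning
  swap : ∀ a b c → a * (b * c) ≡ b * (a * c)
  swap = solve-∀
  swap′ : ∀ a b c → a * (b * c) ≡ b * a * c
  swap′ = solve-∀

-- One term of the series ∑ᵣ multichoose d r yʳ = (1 - y)⁻ᵈ at y = u / (u + w).
multichoose-weight : ∀ u w d r → multichoose d r * (u ^ r * w ^ d) ≤ (u + w) ^ (d + r)
multichoose-weight u w d       zero    = begin
  1 * (1 * w ^ d)      ≡⟨ trans (*-identityˡ _) (*-identityˡ _) ⟩
  w ^ d                ≤⟨ ^-monoˡ-≤ d (m≤n+m w u) ⟩
  (u + w) ^ d          ≡⟨ cong ((u + w) ^_) (+-identityʳ d) ⟨
  (u + w) ^ (d + 0)    ∎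
  where open ≤-Reasoning
multichoose-weight u w zero    (suc r) = z≤n
multichoose-weight u w (suc d) (suc r) = begin
  (x + y) * (u ^ suc r * w ^ suc d)                      ≡⟨ split x y u w (u ^ r) (w ^ d) ⟩
  w * (x * (u ^ suc r * w ^ d)) + u * (y * (u ^ r * w ^ suc d))
    ≤⟨ +-mono-≤ (*-monoʳ-≤ w (multichoose-weight u w d (suc r)))
                (*-monoʳ-≤ u (multichoose-weight u w (suc d) r)) ⟩
  w * (u + w) ^ (d + suc r) + u * (u + w) ^ suc (d + r)
    ≡⟨ cong (λ e → w * (u + w) ^ (d + suc r) + u * (u + w) ^ e) (+-suc d r) ⟨
  w * (u + w) ^ (d + suc r) + u * (u + w) ^ (d + suc r)  ≡⟨ merge u w ((u + w) ^ (d + suc r)) ⟩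
  (u + w) ^ suc (d + suc r)                              ∎
  where
  open ≤-Reasoning
  x = multichoose d (suc r)
  y = multichoose (suc d) r
  split : ∀ x y u w a b → (x + y) * (u * a * (w * b)) ≡ w * (x * (u * a * b)) + u * (y * (a * (w * b)))
  split = solve-∀
  merge : ∀ u w c → w * c + u * c ≡ (u + w) * c
  merge = solve-∀

-- The estimate d^r / r! ≤ y^(-r) (1 - y)^(-d) at y = u / (u + w), with denominators cleared.
power-factorial-bound : ∀ u w d r → d ^ r * (u ^ r * w ^ d) ≤ r ! * (u + w) ^ (d + r)
power-factorial-bound u w d r = begin
  d ^ r * (u ^ r * w ^ d)                        ≤⟨ *-monoˡ-≤ _ (^≤!*multichoose d r) ⟩
  r ! * multichoose d r * (u ^ r * w ^ d)        ≡⟨ *-assoc (r !) _ _ ⟩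
  r ! * (multichoose d r * (u ^ r * w ^ d))      ≤⟨ *-monoʳ-≤ (r !) (multichoose-weight u w d r) ⟩
  r ! * (u + w) ^ (d + r)                        ∎
  where open ≤-Reasoning

!≤∸!*^ : ∀ L {r d} → r ≤ d → 1 ≤ d → r ! ≤ (r ∸ L) ! * d ^ L
!≤∸!*^ zero    {r}     r≤d 1≤d = ≤-reflexive (sym (*-identityʳ (r !)))
!≤∸!*^ (suc L) {r} {d} r≤d 1≤d = begin
  r !                              ≤⟨ !≤∸!*^ L r≤d 1≤d ⟩
  (r ∸ L) ! * d ^ L                ≤⟨ *-monoˡ-≤ (d ^ L) (pred-step (r ∸ L) (≤-trans (m∸n≤m r L) r≤d)) ⟩
  pred (r ∸ L) ! * d * d ^ L       ≡⟨ *-assoc (pred (r ∸ L) !) d (d ^ L) ⟩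
  pred (r ∸ L) ! * (d * d ^ L)     ≡⟨ cong (λ x → x ! * (d * d ^ L)) (pred[m∸n]≡m∸[1+n] r L) ⟩
  (r ∸ suc L) ! * (d * d ^ L)      ∎
  where
  open ≤-Reasoning
  pred-step : ∀ x → x ≤ d → x ! ≤ pred x ! * d
  -- Once r - L is truncated to 0, both factorials are 1 and d ≥ 1 absorbs the extra factor.
  pred-step zero    _   = ≤-trans 1≤d (≤-reflexive (sym (*-identityˡ d)))
  pred-step (suc x) x<d = ≤-trans (≤-reflexive (*-comm (suc x) (x !))) (*-monoʳ-≤ (x !) x<d)

-- For L ≤ r this is the recursion of the factorial. For r ≤ L the truncated differences are at most
-- 1, so both factorials are 1.
suc-∸-!≤ : ∀ r L → (suc r ∸ L) ! ≤ suc (r ∸ L) * (r ∸ L) !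
suc-∸-!≤ r L with ≤-total L r
... | inj₁ L≤r = ≤-reflexive (cong _! (+-∸-assoc 1 L≤r))
... | inj₂ r≤L rewrite m≤n⇒m∸n≡0 r≤L with suc r ∸ L | m≤n+o⇒m∸n≤o (suc r) L {1} (≤-trans (s≤s r≤L) (≤-reflexive (+-comm 1 L)))
...   | zero        | _         = ≤-refl
...   | suc zero    | _         = ≤-refl
...   | suc (suc _) | s≤s ()

cube-cancel-≤ : ∀ {a b} → a * a * a ≤ b * b * b → a ≤ b
cube-cancel-≤ {a} {b} a³≤b³ with a ≤? b
... | yes a≤b = a≤b
... | no  a≰b = contradiction a³≤b³ (<⇒≱ (*-mono-< (*-mono-< b<a b<a) b<a))
  where b<a = ≰⇒> a≰b

-- The fraction p / q is an upper bound for n^(2/3); clearing denominators keeps all estimates in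
-- the natural numbers.
module _ {n p q : ℕ} (2≤n : 2 ≤ n) (1≤q : 1 ≤ q) (n²q³≤p³ : n * n * (q * q * q) ≤ p * p * p) where

  open ≤-Reasoning

  q≤p : q ≤ p
  q≤p = cube-cancel-≤ (≤-trans (≤-trans (≤-reflexive (sym (*-identityˡ _)))
          (*-monoˡ-≤ (q * q * q) (*-mono-≤ 1≤n 1≤n))) n²q³≤p³)
    where 1≤n = ≤-trans (s≤s z≤n) 2≤n

  1≤p : 1 ≤ p
  1≤p = ≤-trans 1≤q q≤p

  -- At p / q = n^(2/3) this reads n^(-1/3) ≤ 7/8. It holds from n = 2 on: after cubing, 8^3 = 512
  -- is below 2 * 7^3 = 686 = 512 + 174.
  8nq²≤7p² : 8 * (n * q * q) ≤ 7 * (p * p)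
  8nq²≤7p² = cube-cancel-≤ (begin
    8 * (n * q * q) * (8 * (n * q * q)) * (8 * (n * q * q))   ≡⟨ e₁ n q ⟩
    512 * (n * n * n * (q * q * q) * (q * q * q))             ≤⟨ *-monoˡ-≤ _ 512≤343n ⟩
    343 * n * (n * n * n * (q * q * q) * (q * q * q))         ≡⟨ e₂ n q ⟩
    343 * ((n * n * (q * q * q)) * (n * n * (q * q * q)))     ≤⟨ *-monoʳ-≤ 343 (*-mono-≤ n²q³≤p³ n²q³≤p³) ⟩
    343 * ((p * p * p) * (p * p * p))                         ≡⟨ e₃ p ⟩
    7 * (p * p) * (7 * (p * p)) * (7 * (p * p))               ∎)
    where
    512≤343n : 512 ≤ 343 * n
    512≤343n = ≤-trans (m≤m+n 512 174) (*-monoʳ-≤ 343 2≤n)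
    e₁ : ∀ n q → 8 * (n * q * q) * (8 * (n * q * q)) * (8 * (n * q * q)) ≡ 512 * (n * n * n * (q * q * q) * (q * q * q))
    e₁ = solve-∀
    e₂ : ∀ n q → 343 * n * (n * n * n * (q * q * q) * (q * q * q)) ≡ 343 * ((n * n * (q * q * q)) * (n * n * (q * q * q)))
    e₂ = solve-∀
    e₃ : ∀ p → 343 * ((p * p * p) * (p * p * p)) ≡ 7 * (p * p) * (7 * (p * p)) * (7 * (p * p))
    e₃ = solve-∀

  -- slack / 2p² is 1 − y for y = nq²/2p², the solution of 2n/y = (2p/q)².
  slack : ℕ
  slack = 2 * (p * p) ∸ n * q * q

  nq²<2p² : n * q * q < 2 * (p * p)
  nq²<2p² = *-cancelˡ-< 8 _ _ (≤-<-trans 8nq²≤7p² (begin-strict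
    7 * (p * p)                <⟨ m<m+n (7 * (p * p)) (*-mono-≤ (s≤s (z≤n {8})) (*-mono-≤ 1≤p 1≤p)) ⟩
    7 * (p * p) + 9 * (p * p)  ≡⟨ e (p * p) ⟩
    8 * (2 * (p * p))          ∎))
    where
    e : ∀ x → 7 * x + 9 * x ≡ 8 * (2 * x)
    e = solve-∀

  slack>0 : 0 < slack
  slack>0 = m<n⇒0<n∸m nq²<2p²

  nq²+slack≡2p² : n * q * q + slack ≡ 2 * (p * p)
  nq²+slack≡2p² = m+[n∸m]≡n (<⇒≤ nq²<2p²)

  -- As 2p^2 = nq^2 + `slack`, the claim reduces to nq^2 (nq + 8p) ≤ 8p^3. On the left, n^2 q^3 is
  -- at most p^3 and 8nq^2 p is at most 7p^3.
  base-bound : 2 * (p * p) * (n * q + 4 * p) ≤ slack * (n * q + 8 * p)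
  base-bound = +-cancelˡ-≤ (n * q * q * (n * q + 8 * p)) _ _ (begin
    n * q * q * (n * q + 8 * p) + v * (n * q + 4 * p)             ≡⟨ cong (_+ v * (n * q + 4 * p)) (e₁ n p q) ⟩
    n * n * (q * q * q) + 8 * (n * q * q) * p + v * (n * q + 4 * p)
      ≤⟨ +-monoˡ-≤ (v * (n * q + 4 * p)) (+-mono-≤ n²q³≤p³ (*-monoˡ-≤ p 8nq²≤7p²)) ⟩
    p * p * p + 7 * (p * p) * p + v * (n * q + 4 * p)             ≡⟨ e₂ n p q ⟩
    v * (n * q + 8 * p)                                           ≡⟨ cong (_* (n * q + 8 * p)) nq²+slack≡2p² ⟨
    (n * q * q + slack) * (n * q + 8 * p)                         ≡⟨ *-distribʳ-+ (n * q + 8 * p) (n * q * q) slack ⟩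
    n * q * q * (n * q + 8 * p) + slack * (n * q + 8 * p)         ∎)
    where
    v = 2 * (p * p)
    e₁ : ∀ n p q → n * q * q * (n * q + 8 * p) ≡ n * n * (q * q * q) + 8 * (n * q * q) * p
    e₁ = solve-∀
    e₂ : ∀ n p q → p * p * p + 7 * (p * p) * p + 2 * (p * p) * (n * q + 4 * p) ≡ 2 * (p * p) * (n * q + 8 * p)
    e₂ = solve-∀

  -- Converts the local bound for one guess on D, with `x` special and `y` ordinary positions, into
  -- the weight of that guess. In `core`, 2r special positions pay for the local bound; each of the
  -- other x - 2r trades a factor q for 2p.
  leaf-bound : ∀ {d L r} len x y → 1 ≤ d → r ≤ d → len * (r ∸ L) ! ≤ (2 * n * d) ^ r →
               2 * r ≤ x → x + y ≡ d →
               len * (q ^ d * slack ^ d) ≤ d ^ L * (2 * (p * p)) ^ d * ((2 * p) ^ x * q ^ y)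
  leaf-bound {d} {L} {r} len x y 1≤d r≤d len-bound 2r≤x x+y≡d = begin
    len * (q ^ d * w ^ d)
      ≡⟨ cong (λ t → len * (t * w ^ d)) q-split ⟩
    len * (q ^ (2 * r) * q ^ e * q ^ y * w ^ d)
      ≡⟨ e₁ len (q ^ (2 * r)) (q ^ e) (q ^ y) (w ^ d) ⟩
    len * q ^ (2 * r) * w ^ d * (q ^ e * q ^ y)
      ≤⟨ *-mono-≤ core (*-monoˡ-≤ (q ^ y) (^-monoˡ-≤ e (≤-trans q≤p (m≤m+n p (p + 0))))) ⟩
    d ^ L * ((2 * p) ^ (2 * r) * v ^ d) * ((2 * p) ^ e * q ^ y)
      ≡⟨ e₂ (d ^ L) ((2 * p) ^ (2 * r)) (v ^ d) ((2 * p) ^ e) (q ^ y) ⟩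
    d ^ L * v ^ d * ((2 * p) ^ (2 * r) * (2 * p) ^ e * q ^ y)
      ≡⟨ cong (λ t → d ^ L * v ^ d * (t * q ^ y)) (trans (sym (^-distribˡ-+-* (2 * p) (2 * r) e)) (cong ((2 * p) ^_) 2r+e≡x)) ⟩
    d ^ L * v ^ d * ((2 * p) ^ x * q ^ y)
      ∎
    where
    v = 2 * (p * p)
    w = slack
    u = n * q * q
    e = x ∸ 2 * r
    2r+e≡x = m+[n∸m]≡n 2r≤x
    q-split : q ^ d ≡ q ^ (2 * r) * q ^ e * q ^ y
    q-split = trans (cong (q ^_) (trans (sym x+y≡d) (cong (_+ y) (sym 2r+e≡x))))
      (trans (^-distribˡ-+-* q (2 * r + e) y) (cong (_* q ^ y) (^-distribˡ-+-* q (2 * r) e)))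
    e₁ : ∀ a b c d e → a * (b * c * d * e) ≡ a * b * e * (c * d)
    e₁ = solve-∀
    e₂ : ∀ a b c d e → a * (b * c) * (d * e) ≡ a * c * (b * d * e)
    e₂ = solve-∀
    square-^ : ∀ t → t ^ (2 * r) ≡ (t * t) ^ r
    square-^ t = trans (sym (^-*-assoc t 2 r)) (cong (λ s → (t * s) ^ r) (*-identityʳ t))
    r!nʳ≢0 : NonZero (r ! * n ^ r)
    r!nʳ≢0 = m*n≢0 (r !) (n ^ r) {{r !≢0}} {{m^n≢0 n r {{>-nonZero (≤-trans (s≤s z≤n) 2≤n)}}}}
    core : len * q ^ (2 * r) * w ^ d ≤ d ^ L * ((2 * p) ^ (2 * r) * v ^ d)
    -- The factor r! is traded for (r - L)! d^L, so that the hypothesis on `len` applies, and n^r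
    -- q^(2r) becomes u^r. The r! from `power-factorial-bound` then cancels, and 2v = (2p)^2
    -- produces (2p)^(2r).
    core = *-cancelʳ-≤ _ _ (r ! * n ^ r) {{r!nʳ≢0}} (begin
      len * q ^ (2 * r) * w ^ d * (r ! * n ^ r)
        ≡⟨ cong (λ t → len * t * w ^ d * (r ! * n ^ r)) (square-^ q) ⟩
      len * (q * q) ^ r * w ^ d * (r ! * n ^ r)
        ≡⟨ f₁ len ((q * q) ^ r) (w ^ d) (r !) (n ^ r) ⟩
      len * r ! * (n ^ r * (q * q) ^ r * w ^ d)
        ≡⟨ cong (λ t → len * r ! * (t * w ^ d)) (trans (sym (^-distribʳ-* n (q * q) r)) (cong (_^ r) (sym (*-assoc n q q)))) ⟩
      len * r ! * (u ^ r * w ^ d)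
        ≤⟨ *-monoˡ-≤ (u ^ r * w ^ d) (*-monoʳ-≤ len (!≤∸!*^ L r≤d 1≤d)) ⟩
      len * ((r ∸ L) ! * d ^ L) * (u ^ r * w ^ d)
        ≡⟨ cong (_* (u ^ r * w ^ d)) (sym (*-assoc len ((r ∸ L) !) (d ^ L))) ⟩
      len * (r ∸ L) ! * d ^ L * (u ^ r * w ^ d)
        ≤⟨ *-monoˡ-≤ (u ^ r * w ^ d) (*-monoˡ-≤ (d ^ L) len-bound) ⟩
      (2 * n * d) ^ r * d ^ L * (u ^ r * w ^ d)
        ≡⟨ cong (λ t → t * d ^ L * (u ^ r * w ^ d)) (trans (^-distribʳ-* (2 * n) d r) (cong (_* d ^ r) (^-distribʳ-* 2 n r))) ⟩
      2 ^ r * n ^ r * d ^ r * d ^ L * (u ^ r * w ^ d)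
        ≡⟨ f₂ (2 ^ r) (n ^ r) (d ^ r) (d ^ L) (u ^ r * w ^ d) ⟩
      2 ^ r * n ^ r * d ^ L * (d ^ r * (u ^ r * w ^ d))
        ≤⟨ *-monoʳ-≤ (2 ^ r * n ^ r * d ^ L) (power-factorial-bound u w d r) ⟩
      2 ^ r * n ^ r * d ^ L * (r ! * (u + w) ^ (d + r))
        ≡⟨ cong (λ t → 2 ^ r * n ^ r * d ^ L * (r ! * t)) (trans (cong (_^ (d + r)) nq²+slack≡2p²) (^-distribˡ-+-* v d r)) ⟩
      2 ^ r * n ^ r * d ^ L * (r ! * (v ^ d * v ^ r))
        ≡⟨ f₃ (2 ^ r) (n ^ r) (d ^ L) (r !) (v ^ d) (v ^ r) ⟩
      d ^ L * (2 ^ r * v ^ r * v ^ d) * (r ! * n ^ r)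
        ≡⟨ cong (λ t → d ^ L * (t * v ^ d) * (r ! * n ^ r)) (trans (sym (^-distribʳ-* 2 v r)) (trans (cong (_^ r) (4p² p)) (sym (square-^ (2 * p))))) ⟩
      d ^ L * ((2 * p) ^ (2 * r) * v ^ d) * (r ! * n ^ r)
        ∎)
      where
      f₁ : ∀ a b c d e → a * b * c * (d * e) ≡ a * d * (e * b * c)
      f₁ = solve-∀
      f₂ : ∀ a b c d e → a * b * c * d * e ≡ a * b * d * (c * e)
      f₂ = solve-∀
      f₃ : ∀ a b c d e f → a * b * c * (d * (e * f)) ≡ c * (a * f * e) * (d * b)
      f₃ = solve-∀
      4p² : ∀ p → 2 * (2 * (p * p)) ≡ 2 * p * (2 * p)
      4p² = solve-∀

  -- The constant 2 comes from d + 1 ≤ 2d, and 2 d^(L+1) is at most 2 d^(2L+2). The d-th power of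
  -- `base-bound` makes `slack` cancel.
  final-bound : ∀ {d L} len → 1 ≤ d →
    len * (q ^ d * slack ^ d) ≤ suc d * (d ^ L * (2 * (p * p)) ^ d * (n * q + 4 * p) ^ d) →
    len * q ^ d ≤ 2 * d ^ (2 * L + 2) * (n * q + 8 * p) ^ d
  final-bound {d} {L} len 1≤d h = *-cancelʳ-≤ _ _ (w ^ d) {{m^n≢0 w d {{>-nonZero slack>0}}}} (begin
    len * q ^ d * w ^ d                             ≡⟨ *-assoc len (q ^ d) (w ^ d) ⟩
    len * (q ^ d * w ^ d)                           ≤⟨ h ⟩
    suc d * (d ^ L * v ^ d * (n * q + 4 * p) ^ d)   ≡⟨ e₁ (suc d) (d ^ L) (v ^ d) ((n * q + 4 * p) ^ d) ⟩
    suc d * d ^ L * (v ^ d * (n * q + 4 * p) ^ d)   ≤⟨ *-mono-≤ poly base ⟩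
    2 * d ^ (2 * L + 2) * (w ^ d * (n * q + 8 * p) ^ d) ≡⟨ e₂ (2 * d ^ (2 * L + 2)) (w ^ d) ((n * q + 8 * p) ^ d) ⟩
    2 * d ^ (2 * L + 2) * (n * q + 8 * p) ^ d * w ^ d   ∎)
    where
    v = 2 * (p * p)
    w = slack
    e₁ : ∀ a b c d → a * (b * c * d) ≡ a * b * (c * d)
    e₁ = solve-∀
    e₂ : ∀ a b c → a * (b * c) ≡ a * c * b
    e₂ = solve-∀
    base : v ^ d * (n * q + 4 * p) ^ d ≤ w ^ d * (n * q + 8 * p) ^ d
    base = begin
      v ^ d * (n * q + 4 * p) ^ d    ≡⟨ ^-distribʳ-* v _ d ⟨
      (v * (n * q + 4 * p)) ^ d      ≤⟨ ^-monoˡ-≤ d base-bound ⟩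
      (w * (n * q + 8 * p)) ^ d      ≡⟨ ^-distribʳ-* w _ d ⟩
      w ^ d * (n * q + 8 * p) ^ d    ∎
    poly : suc d * d ^ L ≤ 2 * d ^ (2 * L + 2)
    poly = begin
      suc d * d ^ L          ≤⟨ *-monoˡ-≤ (d ^ L) (+-mono-≤ 1≤d (≤-reflexive (sym (+-identityʳ d)))) ⟩
      2 * d * d ^ L          ≡⟨ *-assoc 2 d (d ^ L) ⟩
      2 * d ^ suc L          ≤⟨ *-monoʳ-≤ 2 (^-monoʳ-≤ d {{>-nonZero 1≤d}}
                                  (≤-trans (≤-reflexive (+-comm 1 L)) (+-mono-≤ (m≤m+n L (L + 0)) (s≤s z≤n)))) ⟩
      2 * d ^ (2 * L + 2)    ∎

-- The local step

dist≡suc⇒differ : ∀ {n} (a b : Seq n) N {r} → dist N a b ≡ suc r → Σ ℕ λ i → i < N × a i ≢ b i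
dist≡suc⇒differ a b (suc N) eq with a N ≟ b N
... | no  ne = N , ≤-refl , ne
... | yes _  with dist≡suc⇒differ a b N eq
...   | i , i<N , ne = i , m<n⇒m<1+n i<N , ne

dist≡0⇒≡ : ∀ {n} (a b : Seq n) N → dist N a b ≡ 0 → ∀ i → i < N → a i ≡ b i
dist≡0⇒≡ a b N eq i i<N = decidable-stable (a i ≟ b i) λ ne →
  <⇒≱ (s≤s z≤n) (≤-trans (≤-reflexive (sym (δ-≢ ne)))
    (≤-trans (∈⇒≤∑ (λ i → δ (a i) (b i)) (∈-downFrom⁺ i<N)) (≤-reflexive eq)))

dist-self-≔ : ∀ {n} N (a : Seq n) i v → dist N a (a [ i ≔ v ]) ≤ 1
dist-self-≔ N a i v = begin
  dist N a (a [ i ≔ v ])                 ≤⟨ ∑-mono (downFrom N) (λ j _ → pointwise j) ⟩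
  ∑ (downFrom N) (λ j → ι (j ℕ.≟ i))     ≡⟨ length-filter (ℕ._≟ i) (downFrom N) ⟨
  length (filter (ℕ._≟ i) (downFrom N))  ≤⟨ length-≟-filter≤1 ℕ._≟_ (downFrom⁺ N) i ⟩
  1                                      ∎
  where
  open ≤-Reasoning
  pointwise : ∀ j → δ (a j) ((a [ i ≔ v ]) j) ≤ ι (j ℕ.≟ i)
  pointwise j = bySplit (j ℕ.≟ i)
    where
    bySplit : Dec (j ≡ i) → δ (a j) ((a [ i ≔ v ]) j) ≤ ι (j ℕ.≟ i)
    bySplit (yes j≡i) = ≤-trans (δ≤1 (a j) _) (≤-reflexive (sym (ι-yes (j ℕ.≟ i) j≡i)))
    bySplit (no  j≢i) = ≤-trans (≤-reflexive (δ-≡ (sym (≔-there a v j≢i)))) z≤n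

Ball-shift : ∀ {n} {a b : Seq n} {k} → (∀ N → dist N b a ≤ k) → ∀ r → Ball a r ⊆ Ball b (k + r)
Ball-shift {a = a} {b} b~a r c a~c = dist≤⇒DistLe λ N →
  ≤-trans (dist-triangle N b a c) (+-mono-≤ (b~a N) (DistLe⇒dist≤ a~c N))

Distinct : ∀ {n} → List (Seq n) → Set
Distinct = AllPairs (λ x y → ¬ (x ≈ y))

other : ∀ {n} → 2 ≤ n → (x : Fin n) → Σ (Fin n) (_≢ x)
other (s≤s (s≤s _)) fzero    = fsuc fzero , λ ()
other (s≤s (s≤s _)) (fsuc _) = fzero , λ ()

module MaximalSet {n d : ℕ} (2≤n : 2 ≤ n) (S : Subset n) (maximal : Maximal S d) where

  diam≤ : ∀ {a b} → S a → S b → ∀ N → dist N a b ≤ d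
  diam≤ Sa Sb = DistLe⇒dist≤ (proj₁ (proj₁ maximal) _ _ Sa Sb)

  -- A point c of the ball is at most e further than z from any point of `S`, hence within d of it.
  -- So adjoining c keeps the diameter equal to d, and maximality puts c in `S`.
  Ball⊆ : ∀ {z e} → (∀ {s} N → S s → dist N z s + e ≤ d) → Ball z e ⊆ S
  Ball⊆ {z} {e} far c z~c =
    proj₂ maximal T (λ _ → inj₁) (T-diam≤ , T-attained) c (inj₂ refl)
    where
    T : Subset n
    T a = S a ⊎ a ≡ c
    c~ : ∀ {s} → S s → ∀ N → dist N c s ≤ d
    c~ {s} Ss N = begin
      dist N c s               ≤⟨ dist-triangle N c z s ⟩
      dist N c z + dist N z s  ≤⟨ +-monoˡ-≤ _ (subst (_≤ e) (dist-sym N z c) (DistLe⇒dist≤ z~c N)) ⟩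
      e + dist N z s           ≡⟨ +-comm e _ ⟩
      dist N z s + e           ≤⟨ far N Ss ⟩
      d                        ∎
      where open ≤-Reasoning
    T-diam≤ : ∀ a b → T a → T b → DistLe a b d
    T-diam≤ a b (inj₁ Sa)   (inj₁ Sb)   = proj₁ (proj₁ maximal) a b Sa Sb
    T-diam≤ a b (inj₁ Sa)   (inj₂ refl) = dist≤⇒DistLe λ N → subst (_≤ d) (dist-sym N c a) (c~ Sa N)
    T-diam≤ a b (inj₂ refl) (inj₁ Sb)   = dist≤⇒DistLe (c~ Sb)
    T-diam≤ a b (inj₂ refl) (inj₂ refl) = dist≤⇒DistLe λ N →
      ≤-trans (≤-reflexive (trans (∑-cong (downFrom N) (λ i _ → δ-≡ {x = c i} refl))
        (trans (∑-const (downFrom N) 0) (*-zeroʳ (length (downFrom N)))))) z≤n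
    T-attained : Σ _ λ a → Σ _ λ b → T a × T b × DistGe a b d
    T-attained with proj₂ (proj₁ maximal)
    ... | a , b , Sa , Sb , a≁b = a , b , inj₁ Sa , inj₁ Sb , a≁b

  -- The centre can be moved ℓ further away from s inside S, in fresh coordinates.
  Ball⊆⇒dist+ℓ≤d : ∀ ℓ {a s} → Ball a ℓ ⊆ S → S s → ∀ N → dist N a s + ℓ ≤ d
  Ball⊆⇒dist+ℓ≤d zero    {a} {s} ball Ss N = ≤-trans (≤-reflexive (+-identityʳ _))
    (diam≤ (ball a (λ { [] _ _ → z≤n ; (_ ∷ _) _ (ne ∷ _) → contradiction refl ne })) Ss N)
  Ball⊆⇒dist+ℓ≤d (suc ℓ) {a} {s} ball Ss N with other 2≤n (s N)
  ... | v , v≢sN = begin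
    dist N a s + suc ℓ          ≡⟨ +-suc (dist N a s) ℓ ⟩
    suc (dist N a s) + ℓ        ≡⟨ cong (_+ ℓ) (cong₂ _+_ (sym (δ-≢ a′N≢sN)) below) ⟩
    dist (suc N) a′ s + ℓ       ≤⟨ Ball⊆⇒dist+ℓ≤d ℓ ball′ Ss (suc N) ⟩
    d                           ∎
    where
    open ≤-Reasoning
    a′ = a [ N ≔ v ]
    a′N≢sN : a′ N ≢ s N
    a′N≢sN eq = v≢sN (trans (sym (≔-here a {N} v refl)) eq)
    below : dist N a s ≡ dist N a′ s
    below = ∑-cong (downFrom N) (λ j j∈ → cong (λ x → δ x (s j)) (sym (≔-there a v (<⇒≢ (∈-downFrom⁻ j∈)))))
    ball′ : Ball a′ ℓ ⊆ S
    ball′ c c∈ = ball c (Ball-shift (λ M → dist-self-≔ M a N v) ℓ c c∈)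

  module Local {L : ℕ} (noBall : ¬ ContainsBall S (L + 1)) (ℓ : ℕ) where

    Layer-dist : ∀ {a s} → Layer S ℓ a → S s → ∀ N → dist N a s + ℓ ≤ d
    Layer-dist (_ , ball , _) = Ball⊆⇒dist+ℓ≤d ℓ ball

    -- Note that the distance is `suc r`. If all of `S` is closer to z than claimed, then `Ball⊆`
    -- gives a ball around z inside `S`: of radius r + ℓ + 1 when r ≤ L, of the forbidden radius L +
    -- 1 when L ≤ r.
    ¬¬-far : ∀ {z a N r} → Layer S ℓ a → Agree N z a → dist N z a ≡ suc r →
      ¬ ¬ Σ (Seq n) λ s → Σ ℕ λ M → S s × N ≤ M × d + (r ∸ L) ≤ dist M z s + (r + ℓ)
    ¬¬-far {z} {a} {N} {r} (_ , _ , noBall⁺) agree distza k with ≤-total r L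
    ... | inj₁ r≤L = noBall⁺ (b , Ball⁺ , λ c c∈ → Ball⊆ far c (Ball-z c c∈))
      where
      far : ∀ {s} M → S s → dist M z s + (r + suc ℓ) ≤ d
      far {s} M Ss = decidable-stable (_ ≤? _) λ ≰d → k (s , N ⊔ M , Ss , m≤m⊔n N M , (begin
        d + (r ∸ L)                      ≡⟨ cong (d +_) (m≤n⇒m∸n≡0 r≤L) ⟩
        d + 0                            ≡⟨ +-identityʳ d ⟩
        d                                ≤⟨ s≤s⁻¹ (≤-trans (≰⇒> ≰d) (≤-reflexive
                                              (trans (cong (dist M z s +_) (+-suc r ℓ)) (+-suc (dist M z s) (r + ℓ))))) ⟩
        dist M z s + (r + ℓ)             ≤⟨ +-monoˡ-≤ (r + ℓ) (dist-mono z s (m≤n⊔m N M)) ⟩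
        dist (N ⊔ M) z s + (r + ℓ)       ∎))
        where open ≤-Reasoning
      i = proj₁ (dist≡suc⇒differ z a N distza)
      i<N = proj₁ (proj₂ (dist≡suc⇒differ z a N distza))
      zi≢ai = proj₂ (proj₂ (dist≡suc⇒differ z a N distza))
      -- One step from a towards z. This centre is within 1 of a and within r of z, so its (ℓ +
      -- 1)-ball contains `Ball a ℓ` and lies in the ball around z, against a being in the layer.
      b = a [ i ≔ z i ]
      distbz : dist N b z ≡ r
      distbz = suc-injective (trans (sym (dist-≔ i<N (zi≢ai ∘ sym) refl)) (trans (dist-sym N a z) distza))
      agreebz : Agree N b z
      agreebz j N≤j = trans (≔-there a (z i) (>⇒≢ (<-≤-trans i<N N≤j))) (sym (agree j N≤j))
      Ball⁺ : Ball a ℓ ⊆ Ball b (suc ℓ)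
      Ball⁺ = Ball-shift (λ M → subst (_≤ 1) (dist-sym M a b) (dist-self-≔ M a i (z i))) ℓ
      Ball-z : Ball b (suc ℓ) ⊆ Ball z (r + suc ℓ)
      Ball-z = Ball-shift (λ M → subst (_≤ r) (dist-sym M b z) (≤-trans (dist-mono b z (m≤n⊔m N M))
        (≤-reflexive (trans (dist-Agree (m≤m⊔n N M) agreebz) distbz)))) (suc ℓ)
    ... | inj₂ L≤r = noBall (z , Ball⊆ far)
      where
      far : ∀ {s} M → S s → dist M z s + (L + 1) ≤ d
      far {s} M Ss = decidable-stable (_ ≤? _) λ ≰d → k (s , N ⊔ M , Ss , m≤m⊔n N M , (begin
        d + (r ∸ L)                      ≤⟨ +-monoˡ-≤ (r ∸ L) (s≤s⁻¹ (≤-trans (≰⇒> ≰d) (≤-reflexive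
                                              (trans (cong (dist M z s +_) (+-comm L 1)) (+-suc (dist M z s) L))))) ⟩
        dist M z s + L + (r ∸ L)         ≡⟨ +-assoc (dist M z s) L (r ∸ L) ⟩
        dist M z s + (L + (r ∸ L))       ≡⟨ cong (dist M z s +_) (m+[n∸m]≡n L≤r) ⟩
        dist M z s + r                   ≤⟨ +-mono-≤ (dist-mono z s (m≤n⊔m N M)) (m≤m+n r ℓ) ⟩
        dist (N ⊔ M) z s + (r + ℓ)       ∎))
        where open ≤-Reasoning

    -- Induction on r, with z an arbitrary sequence so that its coordinates may be changed freely.
    -- Pairs (a, i) such that z differs at i from both a and s are counted: each a has at least g /
    -- 2 of them, and each of the m positions where z and s differ lies in at most nX / F.
    local-bound : ∀ r → r + ℓ ≤ d → ∀ {z N} ys → Distinct ys → All (Layer S ℓ) ys →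
      All (λ a → Agree N z a × dist N z a ≡ r) ys → length ys * (r ∸ L) ! ≤ (2 * n * d) ^ r
    local-bound zero _ {z} {N} ys ys! _ near = begin
      length ys * (0 ∸ L) !     ≡⟨ cong (λ x → length ys * x !) (0∸n≡0 L) ⟩
      length ys * 1             ≡⟨ *-identityʳ _ ⟩
      length ys                 ≤⟨ length≤1 ys! (λ a b a∈ b∈ i → trans (sym (z≈ a∈ i)) (z≈ b∈ i)) ⟩
      1                         ∎
      where
      open ≤-Reasoning
      z≈ : ∀ {a} → a ∈ ys → z ≈ a
      z≈ {a} a∈ i with i <? N | All.lookup near a∈
      ... | yes i<N | _ , eq    = dist≡0⇒≡ z a N eq i i<N
      ... | no  i≮N | agree , _ = agree i (≮⇒≥ i≮N)
    -- Outside this case the head of the list is the layer element that `¬¬-far` requires.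
    local-bound (suc r) r+ℓ<d [] _ _ _ = z≤n
    local-bound (suc r) r+ℓ<d {z} {N} ys@(_ ∷ _) ys! layer@(layer₀ ∷ _) near@((agree₀ , dist₀) ∷ _) =
      decidable-stable (_ ≤? _) λ ≰ → ¬¬-far layer₀ agree₀ dist₀ λ (s , M , Ss , N≤M , far) →
        ≰ (step s M Ss N≤M far)
      where
      step : ∀ s M → S s → N ≤ M → d + (r ∸ L) ≤ dist M z s + (r + ℓ) →
             length ys * (suc r ∸ L) ! ≤ (2 * n * d) ^ suc r
      step s M Ss N≤M far = *-cancelʳ-≤ _ _ g {{>-nonZero (≤-trans (s≤s z≤n) u≤g)}} (begin
        length ys * (suc r ∸ L) ! * g    ≤⟨ *-monoˡ-≤ g (*-monoʳ-≤ (length ys) (suc-∸-!≤ r L)) ⟩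
        length ys * (u * F) * g          ≡⟨ e₁ (length ys) u F g ⟩
        u * (length ys * g * F)          ≤⟨ *-monoʳ-≤ u double-count ⟩
        u * (2 * (m * (n * X)))          ≡⟨ e₂ u m n X ⟩
        u * m * (2 * n * X)              ≤⟨ *-monoˡ-≤ (2 * n * X) um≤gd ⟩
        g * d * (2 * n * X)              ≡⟨ e₃ g d n X ⟩
        2 * n * d * X * g                ∎)
        where
        open ≤-Reasoning
        m = dist M z s
        u = suc (r ∸ L)
        F = (r ∸ L) !
        X = (2 * n * d) ^ r
        -- The excess of dist(z,s) + dist(z,a) over d - ℓ, which bounds dist(a,s).
        g = m + (suc r + ℓ) ∸ d
        t = d ∸ (suc r + ℓ)
        d+u≤ : d + u ≤ m + (suc r + ℓ)
        d+u≤ = ≤-trans (≤-reflexive (+-suc d (r ∸ L)))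
                 (≤-trans (s≤s far) (≤-reflexive (sym (+-suc m (r + ℓ)))))
        d+g≡ : d + g ≡ m + (suc r + ℓ)
        d+g≡ = m+[n∸m]≡n (≤-trans (m≤m+n d u) d+u≤)
        u≤g : u ≤ g
        u≤g = +-cancelˡ-≤ d _ _ (≤-trans d+u≤ (≤-reflexive (sym d+g≡)))
        t+≡d : t + (suc r + ℓ) ≡ d
        t+≡d = m∸n+n≡m r+ℓ<d
        m≡g+t : m ≡ g + t
        m≡g+t = +-cancelʳ-≡ (suc r + ℓ) m (g + t) (begin-equality
          m + (suc r + ℓ)          ≡⟨ d+g≡ ⟨
          d + g                    ≡⟨ +-comm d g ⟩
          g + d                    ≡⟨ cong (g +_) t+≡d ⟨
          g + (t + (suc r + ℓ))    ≡⟨ +-assoc g t (suc r + ℓ) ⟨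
          g + t + (suc r + ℓ)      ∎)
        -- This is m / g ≤ d / u: for g ≥ u the quotient 1 + t / g is at most (u + t) / u, and u + t
        -- ≤ d.
        um≤gd : u * m ≤ g * d
        um≤gd = begin
          u * m            ≡⟨ cong (u *_) m≡g+t ⟩
          u * (g + t)      ≡⟨ *-distribˡ-+ u g t ⟩
          u * g + u * t    ≤⟨ +-mono-≤ (≤-reflexive (*-comm u g)) (*-monoˡ-≤ t u≤g) ⟩
          g * u + g * t    ≡⟨ *-distribˡ-+ g u t ⟨
          g * (u + t)      ≤⟨ *-monoʳ-≤ g (+-monoˡ-≤ t (≤-trans (s≤s (m∸n≤m r L)) (m≤m+n (suc r) ℓ))) ⟩
          g * (suc r + ℓ + t) ≡⟨ cong (g *_) (trans (+-comm (suc r + ℓ) t) t+≡d) ⟩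
          g * d            ∎
        e₁ : ∀ a u F g → a * (u * F) * g ≡ u * (a * g * F)
        e₁ = solve-∀
        e₂ : ∀ u m n X → u * (2 * (m * (n * X))) ≡ u * m * (2 * n * X)
        e₂ = solve-∀
        e₃ : ∀ g d n X → g * d * (2 * n * X) ≡ 2 * n * d * X * g
        e₃ = solve-∀
        good : Seq n → ℕ
        good a = ∑ (downFrom M) (λ i → δ (z i) (s i) * δ (z i) (a i))
        -- A position where z differs from exactly one of s and a separates a from s; one where it
        -- differs from both is counted twice.
        pointwise : ∀ x y v → δ x y + δ x v ≤ 2 * (δ x y * δ x v) + δ v y
        pointwise x y v with x ≟ y | x ≟ v
        ... | yes refl | yes refl = z≤n
        ... | yes refl | no x≢v   = ≤-reflexive (sym (δ-≢ (x≢v ∘ sym)))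
        ... | no  x≢y  | yes refl = ≤-reflexive (sym (δ-≢ x≢y))
        ... | no  _    | no  _    = m≤m+n 2 _
        g≤2good : ∀ a → a ∈ ys → g ≤ 2 * good a
        g≤2good a a∈ = +-cancelˡ-≤ d _ _ (begin
          d + g                                ≡⟨ d+g≡ ⟩
          m + (suc r + ℓ)                      ≡⟨ +-assoc m (suc r) ℓ ⟨
          m + suc r + ℓ                        ≡⟨ cong (λ x → m + x + ℓ) distM ⟨
          m + dist M z a + ℓ                   ≡⟨ cong (_+ ℓ) (∑-+ (downFrom M) _ _) ⟨
          ∑ (downFrom M) (λ i → δ (z i) (s i) + δ (z i) (a i)) + ℓ
            ≤⟨ +-monoˡ-≤ ℓ (∑-mono (downFrom M) (λ i _ → pointwise (z i) (s i) (a i))) ⟩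
          ∑ (downFrom M) (λ i → 2 * (δ (z i) (s i) * δ (z i) (a i)) + δ (a i) (s i)) + ℓ
            ≡⟨ cong (_+ ℓ) (trans (∑-+ (downFrom M) _ _) (cong (_+ dist M a s) (∑-*ˡ (downFrom M) 2 _))) ⟩
          2 * good a + dist M a s + ℓ          ≡⟨ +-assoc (2 * good a) (dist M a s) ℓ ⟩
          2 * good a + (dist M a s + ℓ)        ≤⟨ +-monoʳ-≤ (2 * good a) (Layer-dist (All.lookup layer a∈) Ss M) ⟩
          2 * good a + d                       ≡⟨ +-comm (2 * good a) d ⟩
          d + 2 * good a                       ∎)
          where
          distM : dist M z a ≡ suc r
          distM = trans (dist-Agree N≤M (proj₁ (All.lookup near a∈))) (proj₂ (All.lookup near a∈))
        differing : ℕ → List (Seq n)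
        differing i = filter (λ a → ¬? (z i ≟ a i)) ys
        fibre-bound : ∀ i → i < M → ∀ v →
          length (filter (λ a → a i ≟ v) (differing i)) * F ≤ X
        -- Setting z to v at i brings the whole fibre to distance r, with `M` as the new cutoff.
        fibre-bound i i<M v = local-bound r (≤-trans (n≤1+n _) r+ℓ<d) {z [ i ≔ v ]} {M} fibre
          (AllPairs-filter⁺ v? (AllPairs-filter⁺ differ? ys!))
          (All-filter⁺ v? (All-filter⁺ differ? layer))
          (All.zipWith near′ (all-filter v? (differing i) ,
            All-filter⁺ v? (All.zipWith id (all-filter differ? ys , All-filter⁺ differ? near))))
          where
          v? = λ (a : Seq n) → a i ≟ v
          differ? = λ (a : Seq n) → ¬? (z i ≟ a i)
          fibre = filter v? (differing i)
          near′ : ∀ {a} → a i ≡ v × z i ≢ a i × Agree N z a × dist N z a ≡ suc r →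
                  Agree M (z [ i ≔ v ]) a × dist M (z [ i ≔ v ]) a ≡ r
          near′ (ai≡v , zi≢ai , agree , distza) =
            (λ j M≤j → trans (≔-there z v (>⇒≢ (<-≤-trans i<M M≤j))) (agree j (≤-trans N≤M M≤j))) ,
            suc-injective (trans (sym (dist-≔ i<M zi≢ai ai≡v)) (trans (dist-Agree N≤M agree) distza))
        column-bound : ∀ i → i < M → ∑ ys (λ a → δ (z i) (a i)) * F ≤ n * X
        column-bound i i<M = begin
          ∑ ys (λ a → δ (z i) (a i)) * F
            ≡⟨ cong (_* F) (length-filter (λ a → ¬? (z i ≟ a i)) ys) ⟨
          length (differing i) * F
            ≤⟨ *-monoˡ-≤ F (length≤∑-fibres _≟_ (λ a → a i) (allFin n) (differing i) (λ a _ → ∈-allFin (a i))) ⟩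
          ∑ (allFin n) (λ v → length (filter (λ a → a i ≟ v) (differing i))) * F
            ≡⟨ ∑-*ʳ (allFin n) F _ ⟨
          ∑ (allFin n) (λ v → length (filter (λ a → a i ≟ v) (differing i)) * F)
            ≤⟨ ∑-bound (allFin n) (λ v _ → fibre-bound i i<M v) ⟩
          length (allFin n) * X
            ≡⟨ cong (_* X) (length-tabulate {n = n} id) ⟩
          n * X ∎
        double-count : length ys * g * F ≤ 2 * (m * (n * X))
        double-count = begin
          length ys * g * F
            ≡⟨ cong (_* F) (∑-const ys g) ⟨
          ∑ ys (λ _ → g) * F
            ≤⟨ *-monoˡ-≤ F (∑-mono ys g≤2good) ⟩
          ∑ ys (λ a → 2 * good a) * F
            ≡⟨ cong (_* F) (∑-*ˡ ys 2 good) ⟩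
          2 * ∑ ys good * F
            ≡⟨ cong (λ x → 2 * x * F) (∑-swap ys (downFrom M) _) ⟩
          2 * ∑ (downFrom M) (λ i → ∑ ys (λ a → δ (z i) (s i) * δ (z i) (a i))) * F
            ≡⟨ *-assoc 2 (∑ (downFrom M) (λ i → ∑ ys (λ a → δ (z i) (s i) * δ (z i) (a i)))) F ⟩
          2 * (∑ (downFrom M) (λ i → ∑ ys (λ a → δ (z i) (s i) * δ (z i) (a i))) * F)
            ≡⟨ cong (2 *_) (∑-*ʳ (downFrom M) F _) ⟨
          2 * ∑ (downFrom M) (λ i → ∑ ys (λ a → δ (z i) (s i) * δ (z i) (a i)) * F)
            ≤⟨ *-monoʳ-≤ 2 (∑-mono (downFrom M) column) ⟩
          2 * ∑ (downFrom M) (λ i → δ (z i) (s i) * (n * X))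
            ≡⟨ cong (2 *_) (∑-*ʳ (downFrom M) (n * X) _) ⟩
          2 * (m * (n * X)) ∎
          where
          column : ∀ i → i ∈ downFrom M →
            ∑ ys (λ a → δ (z i) (s i) * δ (z i) (a i)) * F ≤ δ (z i) (s i) * (n * X)
          column i i∈ = begin
            ∑ ys (λ a → δ (z i) (s i) * δ (z i) (a i)) * F   ≡⟨ cong (_* F) (∑-*ˡ ys (δ (z i) (s i)) _) ⟩
            δ (z i) (s i) * ∑ ys (λ a → δ (z i) (a i)) * F   ≡⟨ *-assoc (δ (z i) (s i)) _ F ⟩
            δ (z i) (s i) * (∑ ys (λ a → δ (z i) (a i)) * F) ≤⟨ *-monoʳ-≤ (δ (z i) (s i)) (column-bound i (∈-downFrom⁻ i∈)) ⟩
            δ (z i) (s i) * (n * X)                          ∎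

-- The global step

-- Weighted guessing on `js`: the weights of all assignments add up to the product of the coordinate
-- sums. Coordinates are fixed one at a time; `κ` collects the weights of the values already chosen,
-- and `c₀` supplies the values off `js`.
branch : ∀ {n} (ω : ℕ → Fin n → ℕ) (K : ℕ) {js} → Unique js →
  ∀ {Q : Seq n → Set} κ (c₀ : Seq n) ys → Distinct ys → All Q ys →
  (∀ (c : Seq n) zs → Distinct zs → All Q zs → All (λ a → All (λ i → a i ≡ c i) js) zs →
    length zs * K ≤ κ * ∏ js (λ i → ω i (c i))) →
  length ys * K ≤ κ * ∏ js (λ i → ∑ (allFin n) (ω i))
branch         ω K []               κ c₀ ys ys! Qys leaf =
  leaf c₀ ys ys! Qys (All.map (λ _ → []) Qys)
branch {n} ω K {j ∷ js} (j∉js ∷ js!) {Q} κ c₀ ys ys! Qys leaf = begin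
  length ys * K
    ≤⟨ *-monoˡ-≤ K (length≤∑-fibres _≟_ (λ a → a j) (allFin n) ys (λ a _ → ∈-allFin (a j))) ⟩
  ∑ (allFin n) (λ v → length (fibre v)) * K
    ≡⟨ ∑-*ʳ (allFin n) K _ ⟨
  ∑ (allFin n) (λ v → length (fibre v) * K)
    ≤⟨ ∑-mono (allFin n) (λ v _ → fibre-bound v) ⟩
  ∑ (allFin n) (λ v → κ * ω j v * P)
    ≡⟨ ∑-*ʳ (allFin n) P _ ⟩
  ∑ (allFin n) (λ v → κ * ω j v) * P
    ≡⟨ cong (_* P) (∑-*ˡ (allFin n) κ (ω j)) ⟩
  κ * ∑ (allFin n) (ω j) * P
    ≡⟨ *-assoc κ _ P ⟩
  κ * (∑ (allFin n) (ω j) * P)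
    ∎
  where
  open ≤-Reasoning
  P = ∏ js (λ i → ∑ (allFin n) (ω i))
  fibre : Fin n → List (Seq n)
  fibre v = filter (λ a → a j ≟ v) ys
  fibre-bound : ∀ v → length (fibre v) * K ≤ κ * ω j v * P
  fibre-bound v = branch ω K js! {λ a → a j ≡ v × Q a} (κ * ω j v) c₀ (fibre v)
    (AllPairs-filter⁺ v? ys!) (All.zipWith id (all-filter v? ys , All-filter⁺ v? Qys)) leaf′
    where
    v? = λ (a : Seq _) → a j ≟ v
    leaf′ : ∀ c zs → Distinct zs → All (λ a → a j ≡ v × Q a) zs →
      All (λ a → All (λ i → a i ≡ c i) js) zs →
      length zs * K ≤ κ * ω j v * ∏ js (λ i → ω i (c i))
    leaf′ c zs zs! Qzs agree = begin
      length zs * K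
        ≤⟨ leaf c′ zs zs! (All.map proj₂ Qzs) (All.zipWith agree′ (Qzs , agree)) ⟩
      κ * (ω j (c′ j) * ∏ js (λ i → ω i (c′ i)))
        ≡⟨ cong₂ (λ x y → κ * (x * y)) (cong (ω j) (≔-here c {j} v refl))
             (∏-cong js (λ i i∈ → cong (ω i) (c′≡c i∈))) ⟩
      κ * (ω j v * ∏ js (λ i → ω i (c i)))
        ≡⟨ *-assoc κ (ω j v) _ ⟨
      κ * ω j v * ∏ js (λ i → ω i (c i))
        ∎
      where
      -- Records the guess at j; as j is not in `js`, the later guesses stay intact.
      c′ = c [ j ≔ v ]
      c′≡c : ∀ {i} → i ∈ js → c′ i ≡ c i
      c′≡c i∈ = ≔-there c v (All.lookup j∉js i∈ ∘ sym)
      agree′ : ∀ {a} → (a j ≡ v × Q a) × All (λ i → a i ≡ c i) js → All (λ i → a i ≡ c′ i) (j ∷ js)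
      agree′ ((aj≡v , _) , a≡c) = trans aj≡v (sym (≔-here c {j} v refl)) ∷
        All.tabulate (λ i∈ → trans (All.lookup a≡c i∈) (sym (c′≡c i∈)))

module DiametralPair {n : ℕ} (z₀ s₀ : Seq n) (p q : ℕ) where

  special : ℕ → Fin n → Bool
  special i v = does (v ≟ z₀ i) ∨ does (v ≟ s₀ i)

  -- The weights 2n^(2/3) and 1 of the global step, scaled by q.
  ω : ℕ → Fin n → ℕ
  ω i v = if special i v then 2 * p else q

  specials ordinaries : List ℕ → Seq n → ℕ
  specials   js c = ∑ js (λ i → if special i (c i) then 1 else 0)
  ordinaries js c = ∑ js (λ i → if special i (c i) then 0 else 1)

  ∏-ω : ∀ js c → ∏ js (λ i → ω i (c i)) ≡ (2 * p) ^ specials js c * q ^ ordinaries js c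
  ∏-ω []       c = refl
  ∏-ω (j ∷ js) c with special j (c j)
  ... | true  = trans (cong (2 * p *_) (∏-ω js c)) (sym (*-assoc (2 * p) _ _))
  ... | false = trans (cong (q *_) (∏-ω js c)) (swap q ((2 * p) ^ specials js c) (q ^ ordinaries js c))
    where
    swap : ∀ a b c → a * (b * c) ≡ b * (a * c)
    swap = solve-∀

  specials+ordinaries : ∀ js c → specials js c + ordinaries js c ≡ length js
  specials+ordinaries []       c = refl
  specials+ordinaries (j ∷ js) c with special j (c j)
  ... | true  = cong suc (specials+ordinaries js c)
  ... | false = trans (+-suc _ _) (cong suc (specials+ordinaries js c))

  ∑-ω : ∀ i → ∑ (allFin n) (ω i) ≤ n * q + 4 * p
  ∑-ω i = begin
    ∑ (allFin n) (ω i)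
      ≤⟨ ∑-mono (allFin n) (λ v _ → pointwise v) ⟩
    ∑ (allFin n) (λ v → q + (ι (v ≟ z₀ i) + ι (v ≟ s₀ i)) * (2 * p))
      ≡⟨ ∑-+ (allFin n) _ _ ⟩
    ∑ (allFin n) (λ _ → q) + ∑ (allFin n) (λ v → (ι (v ≟ z₀ i) + ι (v ≟ s₀ i)) * (2 * p))
      ≡⟨ cong₂ _+_ (trans (∑-const (allFin n) q) (cong (_* q) (length-tabulate {n = n} id)))
           (trans (∑-*ʳ (allFin n) (2 * p) _) (cong (_* (2 * p)) (∑-+ (allFin n) _ _))) ⟩
    n * q + (∑ (allFin n) (λ v → ι (v ≟ z₀ i)) + ∑ (allFin n) (λ v → ι (v ≟ s₀ i))) * (2 * p)
      ≤⟨ +-monoʳ-≤ (n * q) (*-monoˡ-≤ (2 * p) (+-mono-≤ (once (z₀ i)) (once (s₀ i)))) ⟩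
    n * q + 2 * (2 * p)
      ≡⟨ cong (n * q +_) (sym (*-assoc 2 2 p)) ⟩
    n * q + 4 * p ∎
    where
    open ≤-Reasoning
    pointwise : ∀ v → ω i v ≤ q + (ι (v ≟ z₀ i) + ι (v ≟ s₀ i)) * (2 * p)
    pointwise v with does (v ≟ z₀ i) | does (v ≟ s₀ i)
    ... | false | false = ≤-reflexive (sym (+-identityʳ q))
    ... | false | true  = ≤-trans (≤-reflexive (sym (*-identityˡ (2 * p)))) (m≤n+m _ q)
    ... | true  | false = ≤-trans (≤-reflexive (sym (*-identityˡ (2 * p)))) (m≤n+m _ q)
    ... | true  | true  = ≤-trans (m≤m+n (2 * p) _) (m≤n+m _ q)
    once : ∀ x → ∑ (allFin n) (λ v → ι (v ≟ x)) ≤ 1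
    once x = ≤-trans (≤-reflexive (sym (length-filter (_≟ x) (allFin n))))
                     (length-≟-filter≤1 _≟_ (allFin⁺ n) x)

  differ? : ∀ i → Dec (z₀ i ≢ s₀ i)
  differ? i = ¬? (z₀ i ≟ s₀ i)

  D : ℕ → List ℕ
  D N = filter differ? (downFrom N)

  length-D : ∀ N → length (D N) ≡ dist N z₀ s₀
  length-D N = length-filter differ? (downFrom N)

  -- The number r of the global step: deviations from z₀ at positions below `N` outside D.
  offDist : ℕ → Seq n → ℕ
  offDist N a = ∑ (downFrom N) (λ i → ι (z₀ i ≟ s₀ i) * δ (z₀ i) (a i))

  offDist≤dist : ∀ N a → offDist N a ≤ dist N z₀ a
  offDist≤dist N a = ∑-mono (downFrom N) (λ i _ → pointwise i)
    where
    pointwise : ∀ i → ι (z₀ i ≟ s₀ i) * δ (z₀ i) (a i) ≤ δ (z₀ i) (a i)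
    pointwise i with does (z₀ i ≟ s₀ i)
    ... | true  = ≤-reflexive (*-identityˡ _)
    ... | false = z≤n

  -- Checked position by position. On D, an ordinary value differs from both z₀ and s₀, while a
  -- special one differs from one of them and is counted once more in `specials`. Off D, a deviation
  -- counts in both distances.
  2dist+2offDist≤ : ∀ N a →
    2 * dist N z₀ s₀ + 2 * offDist N a ≤ dist N a z₀ + dist N a s₀ + specials (D N) a
  2dist+2offDist≤ N a = begin
    2 * dist N z₀ s₀ + 2 * offDist N a
      ≡⟨ cong₂ _+_ (∑-*ˡ (downFrom N) 2 _) (∑-*ˡ (downFrom N) 2 _) ⟨
    ∑ (downFrom N) (λ i → 2 * δ (z₀ i) (s₀ i)) + ∑ (downFrom N) (λ i → 2 * (ι (z₀ i ≟ s₀ i) * δ (z₀ i) (a i)))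
      ≡⟨ ∑-+ (downFrom N) _ _ ⟨
    ∑ (downFrom N) (λ i → 2 * δ (z₀ i) (s₀ i) + 2 * (ι (z₀ i ≟ s₀ i) * δ (z₀ i) (a i)))
      ≤⟨ ∑-mono (downFrom N) (λ i _ → pointwise i) ⟩
    ∑ (downFrom N) (λ i → δ (a i) (z₀ i) + δ (a i) (s₀ i) + ι (differ? i) * (if special i (a i) then 1 else 0))
      ≡⟨ trans (∑-+ (downFrom N) _ _) (cong₂ _+_ (∑-+ (downFrom N) _ _) (sym (∑-filter differ? (downFrom N) _))) ⟩
    dist N a z₀ + dist N a s₀ + specials (D N) a ∎
    where
    open ≤-Reasoning
    pointwise : ∀ i → 2 * δ (z₀ i) (s₀ i) + 2 * (ι (z₀ i ≟ s₀ i) * δ (z₀ i) (a i)) ≤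
      δ (a i) (z₀ i) + δ (a i) (s₀ i) + ι (differ? i) * (if special i (a i) then 1 else 0)
    pointwise i rewrite δ-sym (z₀ i) (a i) = go (z₀ i) (s₀ i) (a i)
      where
      go : ∀ x y v → 2 * δ x y + 2 * (ι (x ≟ y) * δ v x) ≤
        δ v x + δ v y + ι (¬? (x ≟ y)) * (if does (v ≟ x) ∨ does (v ≟ y) then 1 else 0)
      go x y v with x ≟ y | v ≟ x | v ≟ y
      ... | yes refl | yes _    | _        = z≤n
      ... | yes refl | no  v≢x  | yes v≡x  = contradiction v≡x v≢x
      ... | yes refl | no  _    | no _     = ≤-refl
      ... | no x≢y   | yes refl | yes refl = contradiction refl x≢y
      ... | no x≢y   | yes refl | no  _    = ≤-refl
      ... | no x≢y   | no  _    | yes _    = ≤-refl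
      ... | no x≢y   | no  _    | no  _    = ≤-refl

  -- The centre for the local step: the guess on D and z₀ elsewhere, so that sequences matching the
  -- guess differ from it only off D.
  overwrite : Seq n → Seq n
  overwrite c i = if does (z₀ i ≟ s₀ i) then z₀ i else c i

  overwrite-≡ : ∀ c i → z₀ i ≡ s₀ i → overwrite c i ≡ z₀ i
  overwrite-≡ c i eq rewrite dec-true (z₀ i ≟ s₀ i) eq = refl

  dist-overwrite : ∀ N c {a} → All (λ i → a i ≡ c i) (D N) → dist N (overwrite c) a ≡ offDist N a
  dist-overwrite N c {a} a≡c = ∑-cong (downFrom N) pointwise
    where
    pointwise : ∀ i → i ∈ downFrom N → δ (overwrite c i) (a i) ≡ ι (z₀ i ≟ s₀ i) * δ (z₀ i) (a i)
    pointwise i i∈ with z₀ i ≟ s₀ i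
    ... | yes _  = sym (*-identityˡ _)
    ... | no  ne = δ-≡ (sym (All.lookup a≡c (∈-filter⁺ differ? i∈ ne)))

Layer-count : ∀ {n d L} (2≤n : 2 ≤ n) → 1 ≤ d → (S : Subset n) → Maximal S d → ¬ ContainsBall S (L + 1) →
  ∀ ℓ xs → Distinct xs → All (Layer S ℓ) xs →
  ∀ p q (1≤q : 1 ≤ q) (h : n * n * (q * q * q) ≤ p * p * p) →
  ∀ z₀ s₀ → S z₀ → S s₀ → ∀ N → dist N z₀ s₀ ≡ d → Agree N z₀ s₀ → All (Agree N z₀) xs →
  length xs * (q ^ d * slack {n} {p} 2≤n 1≤q h ^ d) ≤
    suc d * (d ^ L * (2 * (p * p)) ^ d * (n * q + 4 * p) ^ d)
Layer-count {n} {d} {L} 2≤n 1≤d S maximal noBall ℓ xs xs! layer p q 1≤q h z₀ s₀ Sz₀ Ss₀ N dist≡d agree-s₀ agree = begin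
  length xs * K
    -- The classes are r = 0, ..., d, since an element of the layer is within d - ℓ of z₀; hence the
    -- factor d + 1.
    ≤⟨ *-monoˡ-≤ K (length≤∑-fibres ℕ._≟_ (offDist N) (downFrom (suc d)) xs
         (λ a a∈ → ∈-downFrom⁺ (s≤s (m+n≤o⇒m≤o _ (off+ℓ≤d (All.lookup layer a∈)))))) ⟩
  ∑ (downFrom (suc d)) (λ r → length (class r)) * K
    ≡⟨ ∑-*ʳ (downFrom (suc d)) K (λ r → length (class r)) ⟨
  ∑ (downFrom (suc d)) (λ r → length (class r) * K)
    ≤⟨ ∑-bound (downFrom (suc d)) (λ r _ → class-bound r) ⟩
  length (downFrom (suc d)) * (κ * (n * q + 4 * p) ^ d)
    ≡⟨ cong (_* (κ * (n * q + 4 * p) ^ d)) (length-downFrom (suc d)) ⟩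
  suc d * (κ * (n * q + 4 * p) ^ d)
    ∎
  where
  open ≤-Reasoning
  open DiametralPair z₀ s₀ p q
  open MaximalSet 2≤n S maximal
  open Local noBall ℓ
  K = q ^ d * slack {n} {p} 2≤n 1≤q h ^ d
  κ = d ^ L * (2 * (p * p)) ^ d
  off+ℓ≤d : ∀ {a} → Layer S ℓ a → offDist N a + ℓ ≤ d
  off+ℓ≤d {a} la = ≤-trans (+-monoˡ-≤ ℓ (≤-trans (offDist≤dist N a) (≤-reflexive (dist-sym N z₀ a))))
                           (Layer-dist la Sz₀ N)
  class : ℕ → List (Seq n)
  class r = filter (λ a → offDist N a ℕ.≟ r) xs
  Q : ℕ → Seq n → Set
  Q r a = offDist N a ≡ r × Layer S ℓ a × Agree N z₀ a
  length-D≡d : length (D N) ≡ d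
  length-D≡d = trans (length-D N) dist≡d
  leaf : ∀ r c zs → Distinct zs → All (Q r) zs → All (λ a → All (λ i → a i ≡ c i) (D N)) zs →
    length zs * K ≤ κ * ∏ (D N) (λ i → ω i (c i))
  leaf r c []          _   _                     _            = z≤n
  -- A member a of the leaf is what yields r + ℓ ≤ d and, through its distances to z₀ and s₀, 2r ≤
  -- `specials (D N) c`.
  leaf r c zs@(a ∷ _)  zs! Qzs@((refl , la , _) ∷ _) a≡c@(a≡c₀ ∷ _) = begin
    length zs * K
      ≤⟨ leaf-bound {n} {p} 2≤n 1≤q h {L = L} (length zs) (specials (D N) c) (ordinaries (D N) c) 1≤d
           (m+n≤o⇒m≤o _ (off+ℓ≤d la))
           (local-bound r (off+ℓ≤d la) {overwrite c} {N} zs zs! (All.map (proj₁ ∘ proj₂) Qzs) (All.zipWith near (Qzs , a≡c)))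
           2r≤specials
           (trans (specials+ordinaries (D N) c) length-D≡d) ⟩
    κ * ((2 * p) ^ specials (D N) c * q ^ ordinaries (D N) c)
      ≡⟨ cong (κ *_) (∏-ω (D N) c) ⟨
    κ * ∏ (D N) (λ i → ω i (c i)) ∎
    where
    near : ∀ {b} → Q r b × All (λ i → b i ≡ c i) (D N) →
           Agree N (overwrite c) b × dist N (overwrite c) b ≡ r
    near ((off≡r , _ , agree-b) , b≡c) =
      (λ i N≤i → trans (overwrite-≡ c i (agree-s₀ i N≤i)) (agree-b i N≤i)) ,
      trans (dist-overwrite N c b≡c) off≡r
    2r≤specials : 2 * offDist N a ≤ specials (D N) c
    2r≤specials = +-cancelˡ-≤ (2 * d) _ _ (begin
      2 * d + 2 * offDist N a                         ≡⟨ cong (λ x → 2 * x + 2 * offDist N a) dist≡d ⟨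
      2 * dist N z₀ s₀ + 2 * offDist N a              ≤⟨ 2dist+2offDist≤ N a ⟩
      dist N a z₀ + dist N a s₀ + specials (D N) a    ≤⟨ +-monoˡ-≤ _ (+-mono-≤ (diam≤ (proj₁ la) Sz₀ N)
                                                           (≤-trans (diam≤ (proj₁ la) Ss₀ N) (≤-reflexive (sym (+-identityʳ d))))) ⟩
      2 * d + specials (D N) a                        ≡⟨ cong (2 * d +_) (∑-cong (D N) (λ i i∈ →
                                                           cong (λ v → if special i v then 1 else 0) (All.lookup a≡c₀ i∈))) ⟩
      2 * d + specials (D N) c                        ∎)
  class-bound : ∀ r → length (class r) * K ≤ κ * (n * q + 4 * p) ^ d
  class-bound r = begin
    length (class r) * K
      ≤⟨ branch ω K (AllPairs-filter⁺ differ? (downFrom⁺ N)) {Q r} κ z₀ (class r) (AllPairs-filter⁺ r? xs!)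
           (All.zip (all-filter r? xs , All-filter⁺ r? (All.zip (layer , agree)))) (leaf r) ⟩
    κ * ∏ (D N) (λ i → ∑ (allFin n) (ω i))
      ≤⟨ *-monoʳ-≤ κ (∏-bound (D N) ∑-ω) ⟩
    κ * (n * q + 4 * p) ^ length (D N)
      ≡⟨ cong (λ x → κ * (n * q + 4 * p) ^ x) length-D≡d ⟩
    κ * (n * q + 4 * p) ^ d ∎
    where
    r? = λ a → offDist N a ℕ.≟ r

theorem4 : (n L : ℕ) → 1 ≤ n →
    Σ ℕ λ C →
    (d : ℕ) → 1 ≤ d →
    (S : Subset n) → Maximal S d → ¬ ContainsBall S (L + 1) →
    (ℓ : ℕ) →
    (xs : List (Seq n)) → AllPairs (λ x y → ¬ (x ≈ y)) xs →
    All (Layer S ℓ) xs →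
    (p q : ℕ) → 1 ≤ q → n * n * (q * q * q) ≤ p * p * p →
    length xs * q ^ d ≤ C * d ^ (2 * L + 2) * (n * q + 8 * p) ^ d
-- Over one letter any two sequences agree everywhere, so a diameter d ≥ 1 cannot be attained.
theorem4 (suc zero) L _ = 2 , λ { (suc d) 1≤d S ((_ , a , b , _ , _ , i ∷ _ , _ , ne ∷ _ , _) , _) →
  contradiction (Fin1-≡ (a i) (b i)) ne }
  where
  Fin1-≡ : (x y : Fin 1) → x ≡ y
  Fin1-≡ fzero fzero = refl
theorem4 n@(suc (suc _)) L _ = 2 , λ d 1≤d S maximal noBall ℓ xs xs! layer p q 1≤q n²q³≤p³ →
  -- The goal is decidable, so the cutoff may be taken from under a double negation.
  decidable-stable (_ ≤? _) λ ≰ →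
    let ((_ , z₀ , s₀ , Sz₀ , Ss₀ , z₀≁s₀) , _) = maximal
        2≤n = s≤s (s≤s z≤n)
        open MaximalSet 2≤n S maximal
        N₀ , d≤ = DistGe⇒≤dist z₀≁s₀
    -- The common cutoff is taken beyond `N₀`, so that all d differences of z₀ and s₀ lie below it.
    in ¬¬-All-Agree (diam≤ Sz₀ Ss₀ ∷ All.map (λ (Sa , _) → diam≤ Sz₀ Sa) layer) N₀
         λ { (N , N₀≤N , agree-s₀ ∷ agree) → ≰
           (final-bound {n} {p} 2≤n 1≤q n²q³≤p³ {L = L} (length xs) 1≤d
             (Layer-count 2≤n 1≤d S maximal noBall ℓ xs xs! layer p q 1≤q n²q³≤p³ z₀ s₀ Sz₀ Ss₀ N
               (≤-antisym (diam≤ Sz₀ Ss₀ N) (≤-trans d≤ (dist-mono z₀ s₀ N₀≤N))) agree-s₀ agree)) }
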